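{- Let $n\geq 2$. Every $8$-cycle in $BP_n$, written in canonical form as a sequence of prefix reversal labels, is one of the following: (1) $r_{k}r_{j}r_{i}r_{j}r_{k}r_{k-j+i}r_{i}r_{k-j+i}$, for $1\leq i<j\leq k-1$ and $3\leq k\leq n$; (2) $r_{k}r_{j}r_{k}r_{i}r_{k}r_{j}r_{k}r_{i}$, for $2\leq i,j\leq k-2$, $i+j\leq k$, and $4\leq k\leq n$; (3) $r_{k}r_{i}r_{k}r_{1}r_{k}r_{i}r_{k}r_{1}$, for $2\leq i\leq k-1$ and $3\leq k\leq n$; (4) $r_{k}r_{1}r_{k}r_{1}r_{k}r_{1}r_{k}r_{1}$, for $2\leq k\leq n$.
   Context: A signed permutation of $[\pm n]$ is a bijection $w$ of $[\pm n]=\{ -n,\dots,-1,1,\dots,n\}$ with $w(-i)=-w(i)$, written in window notation $w=[w(1)\cdots w(n)]$, with $\underline{i}=-i$; $B_n$ denotes the group of signed permutations. For $1\leq i\leq n$, $w r_i=[\underline{w(i)}\cdots\underline{w(1)}\,w(i+1)\cdots w(n)]$. The burnt pancake graph $BP_n$ has vertex set $B_n$ and an edge $\{w,wr_i\}$ labeled $r_i$ for each $w\in B_n$, $1\leq i\leq n$. A cycle $w, wr_{i_1}, wr_{i_1}r_{i_2},\dots, wr_{i_1}\cdots r_{i_m}=w$ is denoted by its label sequence $r_{i_1}r_{i_2}\cdots r_{i_m}$; a cycle is in canonical form if its index sequence $i_1,i_2,\dots,i_m$ is lexicographically maximal among the label sequences representing that cycle (over all choices of starting vertex and direction of traversal).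 -}

module Defs where

open import Data.Nat using (ℕ; zero; suc; _+_; _∸_; _≤_; _<_)
open import Data.Integer using (ℤ; -_; ∣_∣)
open import Data.List using (List; []; _∷_; _++_; map; take; drop; reverse; length; upTo)
open import Data.List.Relation.Binary.Permutation.Propositional using (_↭_)
open import Data.List.Relation.Unary.Unique.Propositional using (Unique)
open import Data.List.Relation.Unary.All using (All)
open import Data.Product using (_×_; ∃-syntax)
open import Data.Sum using (_⊎_)
open import Data.Unit using (⊤)
open import Data.Empty using (⊥)
open import Relation.Binary.PropositionalEquality using (_≡_)

-- Window notation: a signed permutation w of [±n] is stored as its window
-- [w(1) ... w(n)], a list of integers.  It is a signed permutation iff the
-- absolute values of its entries are a rearrangement of 1..n.
IsSignedPerm : ℕ → List ℤ → Set
IsSignedPerm n w = map ∣_∣ w ↭ map suc (upTo n)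

-- Right multiplication by the prefix reversal r_i:
-- w r_i = [-w(i) ... -w(1) w(i+1) ... w(n)]
_·r_ : List ℤ → ℕ → List ℤ
w ·r i = reverse (map -_ (take i w)) ++ drop i w

walkVerts : List ℤ → List ℕ → List (List ℤ)
walkVerts w []       = []
walkVerts w (i ∷ is) = w ∷ walkVerts (w ·r i) is

walkEnd : List ℤ → List ℕ → List ℤ
walkEnd w []       = w
walkEnd w (i ∷ is) = walkEnd (w ·r i) is

IsCycle : List ℤ → List ℕ → Set
IsCycle w is = (3 ≤ length is) × (walkEnd w is ≡ w) × Unique (walkVerts w is)

_≤lex_ : List ℕ → List ℕ → Set
[]       ≤lex _        = ⊤
(_ ∷ _)  ≤lex []       = ⊥
(x ∷ xs) ≤lex (y ∷ ys) = (x < y) ⊎ ((x ≡ y) × (xs ≤lex ys))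

rotate : ℕ → List ℕ → List ℕ
rotate k xs = drop k xs ++ take k xs

-- Canonical form: the index sequence is lexicographically maximal among all
-- sequences representing the same cycle, i.e. all rotations of it and of its
-- reverse (choice of starting vertex and direction of traversal).
IsCanonical : List ℕ → Set
IsCanonical is = (k : ℕ) → k < length is →
  (rotate k is ≤lex is) × (rotate k (reverse is) ≤lex is)

form1 form2 : ℕ → ℕ → ℕ → List ℕ
form1 i j k = k ∷ j ∷ i ∷ j ∷ k ∷ (k ∸ j + i) ∷ i ∷ (k ∸ j + i) ∷ []
form2 i j k = k ∷ j ∷ k ∷ i ∷ k ∷ j ∷ k ∷ i ∷ []

form3 : ℕ → ℕ → List ℕ
form3 i k = k ∷ i ∷ k ∷ 1 ∷ k ∷ i ∷ k ∷ 1 ∷ []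

form4 : ℕ → List ℕ
form4 k = k ∷ 1 ∷ k ∷ 1 ∷ k ∷ 1 ∷ k ∷ 1 ∷ []

IsListed : ℕ → List ℕ → Set
IsListed n is =
    (∃[ i ] ∃[ j ] ∃[ k ] (is ≡ form1 i j k) × (1 ≤ i) × (i < j) × (j ≤ k ∸ 1) × (3 ≤ k) × (k ≤ n))
  ⊎ (∃[ i ] ∃[ j ] ∃[ k ] (is ≡ form2 i j k) × (2 ≤ i) × (i ≤ k ∸ 2) × (2 ≤ j) × (j ≤ k ∸ 2)
                                             × (i + j ≤ k) × (4 ≤ k) × (k ≤ n))
  ⊎ (∃[ i ] ∃[ k ] (is ≡ form3 i k) × (2 ≤ i) × (i ≤ k ∸ 1) × (3 ≤ k) × (k ≤ n))
  ⊎ (∃[ k ] (is ≡ form4 k) × (2 ≤ k) × (k ≤ n))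

{-# OPTIONS --safe #-}
module Submission where

-- Relabelling the entries, a closed walk at w is a closed walk at the identity, and a canonical
-- cycle starts by flipping all of the first k = i₁ positions.  A walk is followed symbolically: the
-- values are grouped into blocks of unknown positive size that have moved rigidly so far, and
-- each further flip cuts either between two blocks or inside one, which is then split in two.
-- A flip changes the number of breakpoints (adjacent x, y with y ≠ x + 1) by at most one, so
-- an arrangement with more breakpoints than remaining flips cannot return to the identity.
-- With this bound and the exclusion of backtracking, the finite search ends in only three
-- closed walks: family (1), and r_k r_j r_k r_i r_k r_j r_k r_i with i + j = k or i + j < k.

open import Defs
open import Data.Bool using (Bool; true; false; if_then_else_)
open import Data.Integer using (ℤ; module ℤ; 0ℤ; -_; ∣_∣)
open import Data.Integer.Properties using (neg-involutive; ∣-i∣≡∣i∣)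
open import Data.List using (List; []; _∷_; [_]; _++_; _∷ʳ_; _ʳ++_; map; concatMap; foldr; take; drop;
  reverse; length; upTo)
open import Data.List.Properties using (++-assoc; ++-identityʳ; map-++; map-∘; map-cong; map-id;
  length-++; length-map; length-reverse; length-upTo; reverse-++; reverse-map; reverse-involutive;
  take++drop≡id; take-map; drop-map; concatMap-++; concatMap-map; ≡-dec; ∷-injective)
open import Data.List.Relation.Binary.Permutation.Propositional using (↭-sym; ↭⇒↭ₛ)
open import Data.List.Relation.Binary.Permutation.Propositional.Properties using (All-resp-↭; ↭-length)
open import Data.List.Relation.Unary.All as All using (All; []; _∷_)
import Data.List.Relation.Unary.All.Properties as All
open import Data.List.Relation.Unary.AllPairs using ([]; _∷_)
open import Data.List.Relation.Unary.Any using (Any; here; there)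
import Data.List.Relation.Unary.Any.Properties as Any
open import Data.List.Relation.Unary.Linked using (Linked; [-]; _∷_)
open import Data.List.Relation.Unary.Unique.Propositional using (Unique)
import Data.List.Relation.Unary.Unique.Propositional.Properties as Unique
open import Data.Nat using (ℕ; zero; suc; _+_; _*_; _∸_; _≤_; _<_; _≡ᵇ_; _<?_; z≤n; s≤s; z<s)
open import Data.Nat.Properties
open import Data.Nat.Tactic.RingSolver using (solve-∀)
open import Data.Product using (_×_; _,_; proj₁; proj₂; ∃-syntax)
open import Data.Sum using (_⊎_; inj₁; inj₂)
open import Function using (_∘_; id)
open import Relation.Binary.Definitions using (tri<; tri≈; tri>)
open import Relation.Binary.PropositionalEquality using (_≡_; _≢_; refl; sym; trans; cong; cong₂; subst;
  setoid; module ≡-Reasoning)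
open import Relation.Nullary using (yes; no; contradiction)
open import Relation.Nullary.Decidable using (True; toWitness)
open import Data.List.Relation.Binary.Permutation.Setoid.Properties (setoid ℕ) using (Unique-resp-↭)

-- Prefix reversals over an alphabet with a sign involution.

-- Instantiated at `Entry`, which serves both as symbolic value and as signed block letter, and at
-- the integers, where `flip` unfolds to `_·r_`.
module Reversal {A : Set} (opp : A → A) (opp-involutive : ∀ x → opp (opp x) ≡ x) where

  rev : List A → List A
  rev xs = reverse (map opp xs)

  flip : List A → ℕ → List A
  flip xs i = rev (take i xs) ++ drop i xs

  rev-++ : ∀ xs ys → rev (xs ++ ys) ≡ rev ys ++ rev xs
  rev-++ xs ys = trans (cong reverse (map-++ opp xs ys)) (reverse-++ (map opp xs) (map opp ys))

  rev-∷ : ∀ x xs → rev (x ∷ xs) ≡ rev xs ∷ʳ opp x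
  rev-∷ x xs = rev-++ [ x ] xs

  rev-involutive : ∀ xs → rev (rev xs) ≡ xs
  rev-involutive xs = begin
    reverse (map opp (reverse (map opp xs)))  ≡⟨ cong reverse (reverse-map opp (map opp xs)) ⟩
    reverse (reverse (map opp (map opp xs)))  ≡⟨ reverse-involutive _ ⟩
    map opp (map opp xs)                      ≡⟨ map-∘ xs ⟨
    map (opp ∘ opp) xs                        ≡⟨ map-cong opp-involutive xs ⟩
    map id xs                                 ≡⟨ map-id xs ⟩
    xs                                        ∎
    where open ≡-Reasoning

  length-rev : ∀ xs → length (rev xs) ≡ length xs
  length-rev xs = trans (length-reverse (map opp xs)) (length-map opp xs)

  -- Comparing with `length (take i xs)` rather than with `i` also covers an `i` beyond the end of
  -- the list, so `flip-involutive` holds for every `i`.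
  take-drop-replace : ∀ i xs (ys : List A) → length ys ≡ length (take i xs) →
    take i (ys ++ drop i xs) ≡ ys × drop i (ys ++ drop i xs) ≡ drop i xs
  take-drop-replace zero    xs       []       eq = refl , refl
  take-drop-replace (suc i) []       []       eq = refl , refl
  take-drop-replace (suc i) (x ∷ xs) (y ∷ ys) eq with take-drop-replace i xs ys (suc-injective eq)
  ... | t , d = cong (y ∷_) t , d

  flip-involutive : ∀ xs i → flip (flip xs i) i ≡ xs
  flip-involutive xs i with take-drop-replace i xs (rev (take i xs)) (length-rev (take i xs))
  ... | t , d = begin
    rev (take i (flip xs i)) ++ drop i (flip xs i)  ≡⟨ cong₂ (λ u v → rev u ++ v) t d ⟩
    rev (rev (take i xs)) ++ drop i xs              ≡⟨ cong (_++ drop i xs) (rev-involutive (take i xs)) ⟩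
    take i xs ++ drop i xs                          ≡⟨ take++drop≡id i xs ⟩
    xs                                              ∎
    where open ≡-Reasoning

  take-drop-++ : ∀ xs (ys : List A) → take (length xs) (xs ++ ys) ≡ xs × drop (length xs) (xs ++ ys) ≡ ys
  take-drop-++ []       ys = refl , refl
  take-drop-++ (x ∷ xs) ys with take-drop-++ xs ys
  ... | t , d = cong (x ∷_) t , d

  flip-++ : ∀ xs ys → flip (xs ++ ys) (length xs) ≡ rev xs ++ ys
  flip-++ xs ys with take-drop-++ xs ys
  ... | t , d = cong₂ (λ u v → rev u ++ v) t d

  flip-rev-++ : ∀ xs ys → flip (rev xs ++ ys) (length xs) ≡ xs ++ ys
  flip-rev-++ xs ys = begin
    flip (rev xs ++ ys) (length xs)        ≡⟨ cong (flip (rev xs ++ ys)) (length-rev xs) ⟨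
    flip (rev xs ++ ys) (length (rev xs))  ≡⟨ flip-++ (rev xs) ys ⟩
    rev (rev xs) ++ ys                     ≡⟨ cong (_++ ys) (rev-involutive xs) ⟩
    xs ++ ys                               ∎
    where open ≡-Reasoning

  length-flip : ∀ xs i → length (flip xs i) ≡ length xs
  length-flip xs i = begin
    length (rev (take i xs) ++ drop i xs)         ≡⟨ length-++ (rev (take i xs)) ⟩
    length (rev (take i xs)) + length (drop i xs) ≡⟨ cong (_+ _) (length-rev (take i xs)) ⟩
    length (take i xs) + length (drop i xs)       ≡⟨ length-++ (take i xs) ⟨
    length (take i xs ++ drop i xs)               ≡⟨ cong length (take++drop≡id i xs) ⟩
    length xs                                     ∎
    where open ≡-Reasoning

  flip-++-≤ : ∀ xs ys i → i ≤ length xs → flip (xs ++ ys) i ≡ flip xs i ++ ys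
  flip-++-≤ xs ys i i≤ = trans (cong₂ (λ u v → rev u ++ v) (proj₁ (split xs i i≤)) (proj₂ (split xs i i≤)))
                               (sym (++-assoc (rev (take i xs)) (drop i xs) ys))
    where
    split : ∀ xs i → i ≤ length xs → take i (xs ++ ys) ≡ take i xs × drop i (xs ++ ys) ≡ drop i xs ++ ys
    split xs       zero    _         = refl , refl
    split (x ∷ xs) (suc i) (s≤s i≤) with split xs i i≤
    ... | t , d = cong (x ∷_) t , d

  walk : List A → List ℕ → List A
  walk xs []       = xs
  walk xs (i ∷ is) = walk (flip xs i) is

  -- Flips that stay within `xs` never reach `ys`. This allows a fixed last entry to be appended to
  -- the identity later on.
  walk-++ : ∀ xs ys is → All (_≤ length xs) is → walk (xs ++ ys) is ≡ walk xs is ++ ys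
  walk-++ xs ys []       []         = refl
  walk-++ xs ys (i ∷ is) (i≤ ∷ is≤) =
    trans (cong (λ zs → walk zs is) (flip-++-≤ xs ys i i≤))
          (walk-++ (flip xs i) ys is (All.map (λ j≤ → ≤-trans j≤ (≤-reflexive (sym (length-flip xs i)))) is≤))

-- Signed entries and increasing runs.

-- pos a and neg a stand for the entries a+1 and -(a+1), so that the junk entry 0 is excluded.
data Entry : Set where
  pos neg : ℕ → Entry

opp : Entry → Entry
opp (pos a) = neg a
opp (neg a) = pos a

opp-involutive : ∀ e → opp (opp e) ≡ e
opp-involutive (pos a) = refl
opp-involutive (neg a) = refl

open Reversal opp opp-involutive
module ℤReversal = Reversal -_ neg-involutive

up : ℕ → ℕ → List Entry
up o zero    = []
up o (suc l) = pos o ∷ up (suc o) l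

length-up : ∀ o l → length (up o l) ≡ l
length-up o zero    = refl
length-up o (suc l) = cong suc (length-up (suc o) l)

up-+ : ∀ o l m → up o (l + m) ≡ up o l ++ up (o + l) m
up-+ o zero    m = cong (λ z → up z m) (sym (+-identityʳ o))
up-+ o (suc l) m = cong (pos o ∷_) (trans (up-+ (suc o) l m) (cong (λ z → up (suc o) l ++ up z m) (sym (+-suc o l))))

up-last : ∀ o l → up o (suc l) ≡ up o l ∷ʳ pos (o + l)
up-last o l = trans (cong (up o) (+-comm 1 l)) (up-+ o l 1)

-- Breakpoints

consecutive : Entry → Entry → Bool
consecutive (pos a) (pos b) = b ≡ᵇ suc a
consecutive (neg a) (neg b) = a ≡ᵇ suc b
consecutive (pos a) (neg b) = false
consecutive (neg a) (pos b) = false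

gap : Entry → Entry → ℕ
gap x y = if consecutive x y then 0 else 1

-- The equations `y = x + 1` and `-x = -y + 1` are the same, so reversal with negation preserves
-- breakpoints.
gap-opp : ∀ x y → gap (opp y) (opp x) ≡ gap x y
gap-opp (pos a) (pos b) = refl
gap-opp (pos a) (neg b) = refl
gap-opp (neg a) (pos b) = refl
gap-opp (neg a) (neg b) = refl

gap≤1 : ∀ x y → gap x y ≤ 1
gap≤1 x y with consecutive x y
... | true  = z≤n
... | false = s≤s z≤n

breakpoints : List Entry → ℕ
breakpoints []           = 0
breakpoints (x ∷ [])     = 0
breakpoints (x ∷ y ∷ xs) = gap x y + breakpoints (y ∷ xs)

breakpoints-join : ∀ xs x y ys →
  breakpoints ((xs ∷ʳ x) ++ y ∷ ys) ≡ breakpoints (xs ∷ʳ x) + (gap x y + breakpoints (y ∷ ys))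
breakpoints-join []            x y ys = refl
breakpoints-join (z ∷ [])      x y ys = cong (_+ (gap x y + breakpoints (y ∷ ys))) (sym (+-identityʳ (gap z x)))
breakpoints-join (z ∷ z′ ∷ xs) x y ys =
  trans (cong (gap z z′ +_) (breakpoints-join (z′ ∷ xs) x y ys)) (sym (+-assoc (gap z z′) _ _))

breakpoints-rev : ∀ xs → breakpoints (rev xs) ≡ breakpoints xs
breakpoints-rev []           = refl
breakpoints-rev (x ∷ [])     = refl
breakpoints-rev (x ∷ y ∷ xs) = begin
  breakpoints (rev (x ∷ y ∷ xs))              ≡⟨ cong breakpoints (rev-∷ x (y ∷ xs)) ⟩
  breakpoints (rev (y ∷ xs) ∷ʳ opp x)         ≡⟨ cong (λ zs → breakpoints (zs ∷ʳ opp x)) (rev-∷ y xs) ⟩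
  breakpoints ((rev xs ∷ʳ opp y) ∷ʳ opp x)    ≡⟨ breakpoints-join (rev xs) (opp y) (opp x) [] ⟩
  breakpoints (rev xs ∷ʳ opp y) + (gap (opp y) (opp x) + 0)
    ≡⟨ cong₂ _+_ (trans (cong breakpoints (sym (rev-∷ y xs))) (breakpoints-rev (y ∷ xs)))
                 (trans (+-identityʳ _) (gap-opp x y)) ⟩
  breakpoints (y ∷ xs) + gap x y              ≡⟨ +-comm _ (gap x y) ⟩
  gap x y + breakpoints (y ∷ xs)              ∎
  where open ≡-Reasoning

breakpoints-++-≥ : ∀ xs ys → breakpoints xs + breakpoints ys ≤ breakpoints (xs ++ ys)
breakpoints-++-≥ []            ys       = ≤-refl
breakpoints-++-≥ (x ∷ [])      []       = ≤-refl
breakpoints-++-≥ (x ∷ [])      (y ∷ ys) = m≤n+m _ (gap x y)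
breakpoints-++-≥ (x ∷ x′ ∷ xs) ys       =
  ≤-trans (≤-reflexive (+-assoc (gap x x′) _ _)) (+-monoʳ-≤ (gap x x′) (breakpoints-++-≥ (x′ ∷ xs) ys))

breakpoints-++-≤ : ∀ xs ys → breakpoints (xs ++ ys) ≤ suc (breakpoints xs + breakpoints ys)
breakpoints-++-≤ []            ys       = n≤1+n _
breakpoints-++-≤ (x ∷ [])      []       = z≤n
breakpoints-++-≤ (x ∷ [])      (y ∷ ys) = +-monoˡ-≤ _ (gap≤1 x y)
breakpoints-++-≤ (x ∷ x′ ∷ xs) ys       =
  ≤-trans (+-monoʳ-≤ (gap x x′) (breakpoints-++-≤ (x′ ∷ xs) ys))
          (≤-reflexive (trans (+-suc (gap x x′) _) (cong suc (sym (+-assoc (gap x x′) _ _)))))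

-- Both the reversed prefix and the rest keep their breakpoints, so only the adjacency at the cut
-- can be lost.
breakpoints-flip : ∀ xs i → breakpoints xs ≤ suc (breakpoints (flip xs i))
breakpoints-flip xs i = begin
  breakpoints xs                                          ≡⟨ cong breakpoints (take++drop≡id i xs) ⟨
  breakpoints (take i xs ++ drop i xs)                    ≤⟨ breakpoints-++-≤ (take i xs) (drop i xs) ⟩
  suc (breakpoints (take i xs) + breakpoints (drop i xs)) ≡⟨ cong (λ n → suc (n + breakpoints (drop i xs))) (breakpoints-rev (take i xs)) ⟨
  suc (breakpoints (rev (take i xs)) + breakpoints (drop i xs)) ≤⟨ s≤s (breakpoints-++-≥ (rev (take i xs)) (drop i xs)) ⟩
  suc (breakpoints (flip xs i))                           ∎
  where open ≤-Reasoning

breakpoints-walk : ∀ xs is → breakpoints xs ≤ length is + breakpoints (walk xs is)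
breakpoints-walk xs []       = ≤-refl
breakpoints-walk xs (i ∷ is) = ≤-trans (breakpoints-flip xs i) (s≤s (breakpoints-walk (flip xs i) is))

≡ᵇ-refl : ∀ n → (n ≡ᵇ n) ≡ true
≡ᵇ-refl zero    = refl
≡ᵇ-refl (suc n) = ≡ᵇ-refl n

breakpoints-up : ∀ o l → breakpoints (up o l) ≡ 0
breakpoints-up o zero          = refl
breakpoints-up o (suc zero)    = refl
breakpoints-up o (suc (suc l)) =
  cong₂ _+_ (cong (if_then 0 else 1) (≡ᵇ-refl o)) (breakpoints-up (suc o) (suc l))

-- Words of blocks

-- Block b consists of 1 + ℓ b values, directly above those of block b - 1; o is the bottom of block 0.

Lengths : Set
Lengths = ℕ → ℕ

-- The recursion drops block 0 and moves the origin past it. `splitLengths` and `splitIndex` recurse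
-- in parallel, which is why the origin `o` is kept general.
start : ℕ → Lengths → ℕ → ℕ
start o ℓ zero    = o
start o ℓ (suc b) = start (o + suc (ℓ 0)) (ℓ ∘ suc) b

block : ℕ → Lengths → Entry → List Entry
block o ℓ (pos b) = up (start o ℓ b) (suc (ℓ b))
block o ℓ (neg b) = rev (up (start o ℓ b) (suc (ℓ b)))

expand : ℕ → Lengths → List Entry → List Entry
expand o ℓ = concatMap (block o ℓ)

index : Entry → ℕ
index (pos b) = b
index (neg b) = b

block-opp : ∀ o ℓ x → block o ℓ (opp x) ≡ rev (block o ℓ x)
block-opp o ℓ (pos b) = refl
block-opp o ℓ (neg b) = sym (rev-involutive _)

length-block : ∀ o ℓ x → length (block o ℓ x) ≡ suc (ℓ (index x))
length-block o ℓ (pos b) = length-up (start o ℓ b) (suc (ℓ b))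
length-block o ℓ (neg b) = trans (length-rev (up (start o ℓ b) (suc (ℓ b)))) (length-up (start o ℓ b) (suc (ℓ b)))

expand-rev : ∀ o ℓ w → expand o ℓ (rev w) ≡ rev (expand o ℓ w)
expand-rev o ℓ []      = refl
expand-rev o ℓ (x ∷ w) = begin
  expand o ℓ (rev (x ∷ w))                     ≡⟨ cong (expand o ℓ) (rev-∷ x w) ⟩
  expand o ℓ (rev w ∷ʳ opp x)                  ≡⟨ concatMap-++ (block o ℓ) (rev w) [ opp x ] ⟩
  expand o ℓ (rev w) ++ (block o ℓ (opp x) ++ []) ≡⟨ cong₂ _++_ (expand-rev o ℓ w) (trans (++-identityʳ _) (block-opp o ℓ x)) ⟩
  rev (expand o ℓ w) ++ rev (block o ℓ x)      ≡⟨ rev-++ (block o ℓ x) (expand o ℓ w) ⟨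
  rev (expand o ℓ (x ∷ w))                     ∎
  where open ≡-Reasoning

start-suc : ∀ o ℓ b → start o ℓ (suc b) ≡ suc (start o ℓ b + ℓ b)
start-suc o ℓ zero    = +-suc o (ℓ 0)
start-suc o ℓ (suc b) = start-suc (o + suc (ℓ 0)) (ℓ ∘ suc) b

start-< : ∀ o ℓ {b c} → b < c → start o ℓ b < start o ℓ c
start-< o ℓ {b} {suc c} (s≤s b≤c) = ≤-<-trans (start-≤ (m≤n⇒m<n∨m≡n b≤c))
    (≤-trans (s≤s (m≤m+n _ _)) (≤-reflexive (sym (start-suc o ℓ c))))
  where
  start-≤ : b < c ⊎ b ≡ c → start o ℓ b ≤ start o ℓ c
  start-≤ (inj₁ b<c)  = <⇒≤ (start-< o ℓ b<c)
  start-≤ (inj₂ refl) = ≤-refl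

-- Blocks are nonempty, so their bottoms strictly increase.
start-injective : ∀ o ℓ {b c} → start o ℓ b ≡ start o ℓ c → b ≡ c
start-injective o ℓ {b} {c} eq with <-cmp b c
... | tri< b<c _ _ = contradiction eq (<⇒≢ (start-< o ℓ b<c))
... | tri≈ _ b≡c _ = b≡c
... | tri> _ _ c<b = contradiction (sym eq) (<⇒≢ (start-< o ℓ c<b))

firstEntry lastEntry : ℕ → Lengths → Entry → Entry
firstEntry o ℓ (pos b) = pos (start o ℓ b)
firstEntry o ℓ (neg b) = neg (start o ℓ b + ℓ b)
lastEntry o ℓ x = opp (firstEntry o ℓ (opp x))

block-first : ∀ o ℓ x → ∃[ xs ] block o ℓ x ≡ firstEntry o ℓ x ∷ xs
block-first o ℓ (pos b) = _ , refl
block-first o ℓ (neg b) = rev (up (start o ℓ b) (ℓ b)) ,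
  trans (cong rev (up-last (start o ℓ b) (ℓ b))) (rev-++ (up (start o ℓ b) (ℓ b)) _)

block-last : ∀ o ℓ x → ∃[ xs ] block o ℓ x ≡ xs ∷ʳ lastEntry o ℓ x
block-last o ℓ x with block-first o ℓ (opp x)
... | xs , eq = rev xs , (begin
  block o ℓ x                          ≡⟨ cong (block o ℓ) (opp-involutive x) ⟨
  block o ℓ (opp (opp x))              ≡⟨ block-opp o ℓ (opp x) ⟩
  rev (block o ℓ (opp x))              ≡⟨ cong rev eq ⟩
  rev (firstEntry o ℓ (opp x) ∷ xs)    ≡⟨ rev-∷ _ xs ⟩
  rev xs ∷ʳ lastEntry o ℓ x            ∎)
  where open ≡-Reasoning

≡ᵇ-true : ∀ m n → (m ≡ᵇ n) ≡ true → m ≡ n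
≡ᵇ-true zero    zero    _  = refl
≡ᵇ-true (suc m) (suc n) eq = cong suc (≡ᵇ-true m n eq)

-- A block continuing block `b` starts at `start o ℓ (suc b)`, and the start determines the block.
-- For negated blocks the two exchange roles.
consecutive-block : ∀ o ℓ x y →
  consecutive (lastEntry o ℓ x) (firstEntry o ℓ y) ≡ true → consecutive x y ≡ true
consecutive-block o ℓ (pos b) (pos c) eq
  with refl ← start-injective o ℓ {c} {suc b} (trans (≡ᵇ-true (start o ℓ c) _ eq) (sym (start-suc o ℓ b))) = ≡ᵇ-refl b
consecutive-block o ℓ (neg b) (neg c) eq
  with refl ← start-injective o ℓ {b} {suc c} (trans (≡ᵇ-true (start o ℓ b) _ eq) (sym (start-suc o ℓ c))) = ≡ᵇ-refl c
consecutive-block o ℓ (pos b) (neg c) ()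
consecutive-block o ℓ (neg b) (pos c) ()

gap-block : ∀ o ℓ x y → gap x y ≤ gap (lastEntry o ℓ x) (firstEntry o ℓ y)
gap-block o ℓ x y with consecutive (lastEntry o ℓ x) (firstEntry o ℓ y) in eq
... | false = gap≤1 x y
... | true rewrite consecutive-block o ℓ x y eq = z≤n

-- A breakpoint between two letters survives at the boundary of their blocks, whatever the sizes. A
-- count on the word thus prunes all its expansions at once.
breakpoints-expand : ∀ o ℓ w → breakpoints w ≤ breakpoints (expand o ℓ w)
breakpoints-expand o ℓ []      = z≤n
breakpoints-expand o ℓ (x ∷ []) = z≤n
breakpoints-expand o ℓ (x ∷ y ∷ w)
  with block-last o ℓ x | block-first o ℓ y | breakpoints-expand o ℓ (y ∷ w)
... | xs , eqx | ys , eqy | ih rewrite eqx | eqy = begin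
  gap x y + breakpoints (y ∷ w)                   ≤⟨ +-mono-≤ (gap-block o ℓ x y) ih ⟩
  gap u v + breakpoints (v ∷ rest)                ≤⟨ m≤n+m _ (breakpoints (xs ∷ʳ u)) ⟩
  breakpoints (xs ∷ʳ u) + (gap u v + breakpoints (v ∷ rest)) ≡⟨ breakpoints-join xs u v rest ⟨
  breakpoints ((xs ∷ʳ u) ++ v ∷ rest)             ∎
  where
  open ≤-Reasoning
  u = lastEntry o ℓ x
  v = firstEntry o ℓ y
  rest = ys ++ expand o ℓ w

-- Refining a word by splitting a block

splitLengths : ℕ → ℕ → ℕ → Lengths → Lengths
splitLengths zero    l m ℓ zero          = l
splitLengths zero    l m ℓ (suc zero)    = m
splitLengths zero    l m ℓ (suc (suc c)) = ℓ (suc c)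
splitLengths (suc b) l m ℓ zero          = ℓ 0
splitLengths (suc b) l m ℓ (suc c)       = splitLengths b l m (ℓ ∘ suc) c

splitIndex : ℕ → ℕ → List ℕ
splitIndex zero    zero    = 0 ∷ 1 ∷ []
splitIndex zero    (suc c) = suc (suc c) ∷ []
splitIndex (suc b) zero    = 0 ∷ []
splitIndex (suc b) (suc c) = map suc (splitIndex b c)

splitEntry : ℕ → Entry → List Entry
splitEntry b (pos c) = map pos (splitIndex b c)
splitEntry b (neg c) = rev (map pos (splitIndex b c))

splitWord : ℕ → List Entry → List Entry
splitWord b = concatMap (splitEntry b)

-- The halves in reading order: a negated block runs backwards, so its upper half comes first.
half₁ half₂ : Entry → Entry
half₁ (pos b) = pos b
half₁ (neg b) = neg (suc b)
half₂ (pos b) = pos (suc b)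
half₂ (neg b) = neg b

splitIndex-self : ∀ b → splitIndex b b ≡ b ∷ suc b ∷ []
splitIndex-self zero    = refl
splitIndex-self (suc b) = cong (map suc) (splitIndex-self b)

splitEntry-self : ∀ x → splitEntry (index x) x ≡ half₁ x ∷ half₂ x ∷ []
splitEntry-self (pos b) = cong (map pos) (splitIndex-self b)
splitEntry-self (neg b) = cong (rev ∘ map pos) (splitIndex-self b)

splitLengths-self₁ : ∀ b l m ℓ → splitLengths b l m ℓ b ≡ l
splitLengths-self₁ zero    l m ℓ = refl
splitLengths-self₁ (suc b) l m ℓ = splitLengths-self₁ b l m (ℓ ∘ suc)

splitLengths-self₂ : ∀ b l m ℓ → splitLengths b l m ℓ (suc b) ≡ m
splitLengths-self₂ zero    l m ℓ = refl
splitLengths-self₂ (suc b) l m ℓ = splitLengths-self₂ b l m (ℓ ∘ suc)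

-- The hypothesis says that the sizes `1 + l` and `1 + m` add up to `1 + ℓ b`.
expand-splitIndex : ∀ b c l m o ℓ → ℓ b ≡ suc (l + m) →
  expand o (splitLengths b l m ℓ) (map pos (splitIndex b c)) ≡ block o ℓ (pos c)
expand-splitIndex zero zero l m o ℓ eq = begin
  up o (suc l) ++ (up (o + suc l) (suc m) ++ [])  ≡⟨ cong (up o (suc l) ++_) (++-identityʳ _) ⟩
  up o (suc l) ++ up (o + suc l) (suc m)          ≡⟨ up-+ o (suc l) (suc m) ⟨
  up o (suc l + suc m)                            ≡⟨ cong (up o ∘ suc) (trans (+-suc l m) (sym eq)) ⟩
  up o (suc (ℓ 0))                                ∎
  where open ≡-Reasoning
expand-splitIndex zero (suc c) l m o ℓ eq = trans (++-identityʳ _)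
  (cong (λ p → up (start p (ℓ ∘ suc) c) (suc (ℓ (suc c)))) (begin
    o + suc l + suc m     ≡⟨ +-assoc o (suc l) (suc m) ⟩
    o + (suc l + suc m)   ≡⟨ cong (λ n → o + suc n) (trans (+-suc l m) (sym eq)) ⟩
    o + suc (ℓ 0)         ∎))
  where open ≡-Reasoning
expand-splitIndex (suc b) zero    l m o ℓ eq = ++-identityʳ _
expand-splitIndex (suc b) (suc c) l m o ℓ eq = begin
  expand o ℓ′ (map pos (map suc (splitIndex b c)))         ≡⟨ concatMap-map (block o ℓ′) pos (map suc (splitIndex b c)) ⟩
  concatMap (block o ℓ′ ∘ pos) (map suc (splitIndex b c))  ≡⟨ concatMap-map (block o ℓ′ ∘ pos) suc (splitIndex b c) ⟩
  -- Raising all letters by one amounts to deleting block 0 and moving the origin past it.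
  concatMap (block o′ (ℓ′ ∘ suc) ∘ pos) (splitIndex b c)   ≡⟨ concatMap-map (block o′ (ℓ′ ∘ suc)) pos (splitIndex b c) ⟨
  expand o′ (ℓ′ ∘ suc) (map pos (splitIndex b c))          ≡⟨ expand-splitIndex b c l m o′ (ℓ ∘ suc) eq ⟩
  block o′ (ℓ ∘ suc) (pos c)                               ∎
  where
  open ≡-Reasoning
  ℓ′ = splitLengths (suc b) l m ℓ
  o′ = o + suc (ℓ 0)

expand-splitWord : ∀ b l m o ℓ → ℓ b ≡ suc (l + m) → ∀ w →
  expand o (splitLengths b l m ℓ) (splitWord b w) ≡ expand o ℓ w
expand-splitWord b l m o ℓ eq []      = refl
expand-splitWord b l m o ℓ eq (x ∷ w) = begin
  expand o ℓ′ (splitEntry b x ++ splitWord b w)             ≡⟨ concatMap-++ (block o ℓ′) (splitEntry b x) (splitWord b w) ⟩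
  expand o ℓ′ (splitEntry b x) ++ expand o ℓ′ (splitWord b w) ≡⟨ cong₂ _++_ (letter x) (expand-splitWord b l m o ℓ eq w) ⟩
  block o ℓ x ++ expand o ℓ w                               ∎
  where
  open ≡-Reasoning
  ℓ′ = splitLengths b l m ℓ
  letter : ∀ x → expand o ℓ′ (splitEntry b x) ≡ block o ℓ x
  letter (pos c) = expand-splitIndex b c l m o ℓ eq
  letter (neg c) = trans (expand-rev o ℓ′ (map pos (splitIndex b c))) (cong rev (expand-splitIndex b c l m o ℓ eq))

-- A linear form in the block sizes 1 + ℓ b, given by its coefficients.

Form : Set
Form = List ℕ

eval : Lengths → Form → ℕ
eval ℓ []      = 0
eval ℓ (a ∷ f) = a * suc (ℓ 0) + eval (ℓ ∘ suc) f

addUnit : ℕ → Form → Form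
addUnit zero    []      = 1 ∷ []
addUnit zero    (a ∷ f) = suc a ∷ f
addUnit (suc b) []      = 0 ∷ addUnit b []
addUnit (suc b) (a ∷ f) = a ∷ addUnit b f

wordLength : List Entry → Form
wordLength = foldr (addUnit ∘ index) []

-- The size of block `b` becomes a sum of two sizes, each inheriting its coefficient.
splitForm : ℕ → Form → Form
splitForm b       []      = []
splitForm zero    (a ∷ f) = a ∷ a ∷ f
splitForm (suc b) (a ∷ f) = a ∷ splitForm b f

eval-addUnit : ∀ ℓ b f → eval ℓ (addUnit b f) ≡ suc (ℓ b) + eval ℓ f
eval-addUnit ℓ zero    []      = cong (_+ 0) (+-identityʳ (suc (ℓ 0)))
eval-addUnit ℓ zero    (a ∷ f) = +-assoc (suc (ℓ 0)) _ _
eval-addUnit ℓ (suc b) []      = eval-addUnit (ℓ ∘ suc) b []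
eval-addUnit ℓ (suc b) (a ∷ f) = trans (cong (a * suc (ℓ 0) +_) (eval-addUnit (ℓ ∘ suc) b f))
  (swap (a * suc (ℓ 0)) (suc (ℓ (suc b))) (eval (ℓ ∘ suc) f))
  where
  swap : ∀ x y z → x + (y + z) ≡ y + (x + z)
  swap = solve-∀

eval-wordLength : ∀ o ℓ w → eval ℓ (wordLength w) ≡ length (expand o ℓ w)
eval-wordLength o ℓ []      = refl
eval-wordLength o ℓ (x ∷ w) = begin
  eval ℓ (addUnit (index x) (wordLength w))       ≡⟨ eval-addUnit ℓ (index x) (wordLength w) ⟩
  suc (ℓ (index x)) + eval ℓ (wordLength w)       ≡⟨ cong₂ _+_ (sym (length-block o ℓ x)) (eval-wordLength o ℓ w) ⟩
  length (block o ℓ x) + length (expand o ℓ w)    ≡⟨ length-++ (block o ℓ x) ⟨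
  length (expand o ℓ (x ∷ w))                     ∎
  where open ≡-Reasoning

eval-splitForm : ∀ b l m ℓ → ℓ b ≡ suc (l + m) → ∀ f → eval (splitLengths b l m ℓ) (splitForm b f) ≡ eval ℓ f
eval-splitForm b       l m ℓ eq []      = refl
eval-splitForm zero    l m ℓ eq (a ∷ f) = begin
  a * suc l + (a * suc m + eval (ℓ ∘ suc) f)  ≡⟨ regroup a l m (eval (ℓ ∘ suc) f) ⟩
  a * suc (suc (l + m)) + eval (ℓ ∘ suc) f    ≡⟨ cong (λ n → a * suc n + eval (ℓ ∘ suc) f) eq ⟨
  a * suc (ℓ 0) + eval (ℓ ∘ suc) f            ∎
  where
  open ≡-Reasoning
  regroup : ∀ a l m e → a * suc l + (a * suc m + e) ≡ a * suc (suc (l + m)) + e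
  regroup = solve-∀
eval-splitForm (suc b) l m ℓ eq (a ∷ f) = cong (a * suc (ℓ 0) +_) (eval-splitForm b l m (ℓ ∘ suc) eq f)

-- Here `l` belongs to the half that is read first, whatever the sign of the block.
refine : Entry → ℕ → ℕ → Lengths → Lengths
refine (pos b) l m = splitLengths b l m
refine (neg b) l m = splitLengths b m l

expand-refine : ∀ x l m ℓ → ℓ (index x) ≡ suc (l + m) → ∀ w →
  expand 0 (refine x l m ℓ) (splitWord (index x) w) ≡ expand 0 ℓ w
expand-refine (pos b) l m ℓ eq = expand-splitWord b l m 0 ℓ eq
expand-refine (neg b) l m ℓ eq = expand-splitWord b m l 0 ℓ (trans eq (cong suc (+-comm l m)))

eval-refine : ∀ x l m ℓ → ℓ (index x) ≡ suc (l + m) → ∀ f →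
  eval (refine x l m ℓ) (splitForm (index x) f) ≡ eval ℓ f
eval-refine (pos b) l m ℓ eq = eval-splitForm b l m ℓ eq
eval-refine (neg b) l m ℓ eq = eval-splitForm b m l ℓ (trans eq (cong suc (+-comm l m)))

refine-half₁ : ∀ x l m ℓ → refine x l m ℓ (index (half₁ x)) ≡ l
refine-half₁ (pos b) l m ℓ = splitLengths-self₁ b l m ℓ
refine-half₁ (neg b) l m ℓ = splitLengths-self₂ b m l ℓ

index-opp : ∀ x → index (opp x) ≡ index x
index-opp (pos b) = refl
index-opp (neg b) = refl

-- Symbolic search for closed walks.

-- search r s t f h explores all ways to return to the identity in r further flips from the
-- arrangement s ++ t, of which t is never moved; f ∷ h are the previous flips, latest first.
-- In flips, s is traversed to choose the block x that the flip cuts, either at its end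
-- or in its interior; p is the reversal of the part in front of x.
search : ℕ → List Entry → List Entry → Form → List Form → List (List Form)
flips : ℕ → List Entry → List Entry → List Entry → Form → List Form → List (List Form)
cutAfter cutInside : ℕ → List Entry → Entry → List Entry → List Entry → Form → List Form → List (List Form)
visit : ℕ → List Entry → List Entry → Form → Form → List Form → List (List Form)

search r s t f h with r <? breakpoints (s ++ t)
... | yes _ = []
... | no  _ = flips r [] s t f h

flips zero    p s       t f h = [ f ∷ h ]
flips (suc r) p []      t f h = []
flips (suc r) p (x ∷ s) t f h =
  cutAfter r p x s t f h ++ cutInside r p x s t f h ++ flips (suc r) (opp x ∷ p) s t f h

cutAfter r p x s t f h = visit r (opp x ∷ p ++ s) t (wordLength (opp x ∷ p)) f h

cutInside r p x s t f h =
  cutAfter r (split p) (half₁ x) (half₂ x ∷ split s) (split t) (splitForm (index x) f) (map (splitForm (index x)) h)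
  where split = splitWord (index x)

visit r s t f g h with ≡-dec _≟_ g f
... | yes _ = []
... | no  _ = search r s t f (g ∷ h)

-- Soundness of the search.

-- One choice of sizes must fit all forms of a history. Histories have the latest flip first, so
-- `ʳ++` puts the coming flips `is` before the past ones `js`; passing a flip from `is` to `js` is
-- then definitional.
Found : List ℕ → List ℕ → List (List Form) → Set
Found is js = Any (λ h → ∃[ ℓ ] map (eval ℓ) h ≡ is ʳ++ js)

Found-cong : ∀ is {js js′ hs} → js ≡ js′ → Found is js hs → Found is js′ hs
Found-cong is refl found = found

-- While `flips` traverses its word, the true arrangement is `rev (expand 0 ℓ p) ++ expand 0 ℓ (s ++
-- t)`; stepping over `x` only divides it differently.
rev-expand-shift : ∀ ℓ p x w → rev (expand 0 ℓ p) ++ expand 0 ℓ (x ∷ w) ≡ rev (expand 0 ℓ (opp x ∷ p)) ++ expand 0 ℓ w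
rev-expand-shift ℓ p x w = begin
  rev (E p) ++ (block 0 ℓ x ++ E w)                 ≡⟨ ++-assoc (rev (E p)) (block 0 ℓ x) (E w) ⟨
  (rev (E p) ++ block 0 ℓ x) ++ E w                 ≡⟨ cong (λ zs → (rev (E p) ++ zs) ++ E w) (rev-involutive (block 0 ℓ x)) ⟨
  (rev (E p) ++ rev (rev (block 0 ℓ x))) ++ E w     ≡⟨ cong (λ zs → (rev (E p) ++ rev zs) ++ E w) (block-opp 0 ℓ x) ⟨
  (rev (E p) ++ rev (block 0 ℓ (opp x))) ++ E w     ≡⟨ cong (_++ E w) (rev-++ (block 0 ℓ (opp x)) (E p)) ⟨
  rev (E (opp x ∷ p)) ++ E w                        ∎
  where
  open ≡-Reasoning
  E = expand 0 ℓ

-- As `p` is stored reversed, flipping everything up to the end of `x` just uncovers it.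
flip-after : ∀ ℓ p x w → flip (rev (expand 0 ℓ p) ++ expand 0 ℓ (x ∷ w)) (length (expand 0 ℓ (opp x ∷ p)))
                         ≡ expand 0 ℓ (opp x ∷ p ++ w)
flip-after ℓ p x w = begin
  flip (rev (E p) ++ E (x ∷ w)) n      ≡⟨ cong (λ zs → flip zs n) (rev-expand-shift ℓ p x w) ⟩
  flip (rev (E (opp x ∷ p)) ++ E w) n  ≡⟨ flip-rev-++ (E (opp x ∷ p)) (E w) ⟩
  E (opp x ∷ p) ++ E w                 ≡⟨ concatMap-++ (block 0 ℓ) (opp x ∷ p) w ⟨
  E (opp x ∷ p ++ w)                   ∎
  where
  open ≡-Reasoning
  E = expand 0 ℓ
  n = length (E (opp x ∷ p))

length-expand-++ : ∀ ℓ v w → length (expand 0 ℓ (v ++ w)) ≡ length (expand 0 ℓ v) + length (expand 0 ℓ w)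
length-expand-++ ℓ v w = trans (cong length (concatMap-++ (block 0 ℓ) v w)) (length-++ (expand 0 ℓ v))

length-expand-∷ : ∀ ℓ x w → length (expand 0 ℓ (x ∷ w)) ≡ suc (ℓ (index x)) + length (expand 0 ℓ w)
length-expand-∷ ℓ x w = trans (length-++ (block 0 ℓ x)) (cong (_+ length (expand 0 ℓ w)) (length-block 0 ℓ x))

length-expand-opp : ∀ ℓ x w → length (expand 0 ℓ (opp x ∷ w)) ≡ suc (ℓ (index x)) + length (expand 0 ℓ w)
length-expand-opp ℓ x w = trans (length-expand-∷ ℓ (opp x) w) (cong (λ b → suc (ℓ b) + length (expand 0 ℓ w)) (index-opp x))

length-shift : ∀ ℓ p x w → length (expand 0 ℓ (opp x ∷ p)) + length (expand 0 ℓ w)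
                           ≡ length (expand 0 ℓ p) + length (expand 0 ℓ (x ∷ w))
length-shift ℓ p x w = begin
  length (expand 0 ℓ (opp x ∷ p)) + n  ≡⟨ cong (_+ n) (length-expand-opp ℓ x p) ⟩
  suc (ℓ (index x)) + m + n            ≡⟨ shuffle (suc (ℓ (index x))) m n ⟩
  m + (suc (ℓ (index x)) + n)          ≡⟨ cong (m +_) (length-expand-∷ ℓ x w) ⟨
  m + length (expand 0 ℓ (x ∷ w))      ∎
  where
  open ≡-Reasoning
  m = length (expand 0 ℓ p)
  n = length (expand 0 ℓ w)
  shuffle : ∀ a b c → a + b + c ≡ b + (a + c)
  shuffle = solve-∀

Bounded : ℕ → List ℕ → Set
Bounded k = All (λ i → 1 ≤ i × i ≤ k)

module _ (N : ℕ) where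

  -- No closing walk is lost, whatever the block sizes. The bound on the labels keeps `t` in place,
  -- and `Linked` forbids repeating the previous flip.
  search-sound : ∀ is s t f h ℓ → walk (expand 0 ℓ (s ++ t)) is ≡ up 0 N →
    Bounded (length (expand 0 ℓ s)) is → Linked _≢_ (eval ℓ f ∷ is) →
    Found is (map (eval ℓ) (f ∷ h)) (search (length is) s t f h)

  -- The strict lower bound on `i` records that the cut lies beyond all blocks passed so far.
  flips-sound : ∀ i is p s t f h ℓ → walk (rev (expand 0 ℓ p) ++ expand 0 ℓ (s ++ t)) (i ∷ is) ≡ up 0 N →
    length (expand 0 ℓ p) < i → Bounded (length (expand 0 ℓ p) + length (expand 0 ℓ s)) (i ∷ is) →
    Linked _≢_ (eval ℓ f ∷ i ∷ is) →
    Found (i ∷ is) (map (eval ℓ) (f ∷ h)) (flips (length (i ∷ is)) p s t f h)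

  visit-sound : ∀ is s t f g h ℓ → walk (expand 0 ℓ (s ++ t)) is ≡ up 0 N →
    Bounded (length (expand 0 ℓ s)) is → Linked _≢_ (eval ℓ g ∷ eval ℓ f ∷ is) →
    Found is (map (eval ℓ) (f ∷ g ∷ h)) (visit (length is) s t f g h)

  cut-sound : ∀ i is p x s t f h ℓ → i ≡ length (expand 0 ℓ (opp x ∷ p)) →
    walk (rev (expand 0 ℓ p) ++ expand 0 ℓ (x ∷ s ++ t)) (i ∷ is) ≡ up 0 N →
    Bounded (length (expand 0 ℓ p) + length (expand 0 ℓ (x ∷ s))) is →
    Linked _≢_ (eval ℓ f ∷ i ∷ is) →
    Found (i ∷ is) (map (eval ℓ) (f ∷ h)) (cutAfter (length is) p x s t f h)

  search-sound is s t f h ℓ eq bd ln with length is <? breakpoints (s ++ t)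
  ... | yes lt = contradiction (begin-strict
    length is                              <⟨ lt ⟩
    breakpoints (s ++ t)                   ≤⟨ breakpoints-expand 0 ℓ (s ++ t) ⟩
    breakpoints (expand 0 ℓ (s ++ t))      ≤⟨ breakpoints-walk (expand 0 ℓ (s ++ t)) is ⟩
    length is + breakpoints (walk (expand 0 ℓ (s ++ t)) is)
      ≡⟨ cong (length is +_) (trans (cong breakpoints eq) (breakpoints-up 0 N)) ⟩
    length is + 0                          ≡⟨ +-identityʳ _ ⟩
    length is                              ∎) (<-irrefl refl)
    where open ≤-Reasoning
  -- A history whose word has no breakpoints when no flips remain is reported without further
  -- checks; the output only has to contain every closing walk.
  search-sound []       s t f h ℓ eq bd              ln | no _ = here (ℓ , refl)
  search-sound (i ∷ is) s t f h ℓ eq (b@(1≤i , _) ∷ bd) ln | no _ = flips-sound i is [] s t f h ℓ eq 1≤i (b ∷ bd) ln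

  visit-sound is s t f g h ℓ eq bd (g≢f ∷ ln) with ≡-dec _≟_ g f
  -- Equal forms have equal values, hence an immediate repetition. Distinct forms of equal value are
  -- merely searched further, which is harmless.
  ... | yes refl = contradiction refl g≢f
  ... | no  _    = search-sound is s t f (g ∷ h) ℓ eq bd ln

  cut-sound i is p x s t f h ℓ refl eq bd ln
    with v ← visit-sound is (opp x ∷ p ++ s) t (wordLength (opp x ∷ p)) f h ℓ
    rewrite eval-wordLength 0 ℓ (opp x ∷ p)
    = v (begin
      walk (expand 0 ℓ ((opp x ∷ p ++ s) ++ t)) is   ≡⟨ cong (λ w → walk (expand 0 ℓ (opp x ∷ w)) is) (++-assoc p s t) ⟩
      walk (expand 0 ℓ (opp x ∷ p ++ (s ++ t))) is   ≡⟨ cong (λ w → walk w is) (flip-after ℓ p x (s ++ t)) ⟨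
      walk (rev (expand 0 ℓ p) ++ expand 0 ℓ (x ∷ s ++ t)) (i ∷ is)  ≡⟨ eq ⟩
      up 0 N                                         ∎)
      (subst (λ k → Bounded k is) (sym (trans (length-expand-++ ℓ (opp x ∷ p) s) (length-shift ℓ p x s))) bd)
      ln
    where open ≡-Reasoning

  -- After splitting the block, an interior cut is a cut at a block end; the refined sizes change
  -- neither the arrangement nor the past labels.
  interior-sound : ∀ i is p x s t f h ℓ → length (expand 0 ℓ p) < i → i < length (expand 0 ℓ (opp x ∷ p)) →
    walk (rev (expand 0 ℓ p) ++ expand 0 ℓ (x ∷ s ++ t)) (i ∷ is) ≡ up 0 N →
    Bounded (length (expand 0 ℓ p) + length (expand 0 ℓ (x ∷ s))) is →
    Linked _≢_ (eval ℓ f ∷ i ∷ is) →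
    Found (i ∷ is) (map (eval ℓ) (f ∷ h)) (cutInside (length is) p x s t f h)
  interior-sound i is p x s t f h ℓ lo hi eq bd ln with m≤n⇒∃[o]m+o≡n lo
  -- The cut leaves `1 + a` entries of the block in front and `1 + m` behind; the strict bounds make
  -- both parts nonempty.
  ... | a , refl with m≤n⇒∃[o]m+o≡n (+-cancelʳ-< (length (expand 0 ℓ p)) (suc a) (suc (ℓ (index x)))
                       (subst (suc a + length (expand 0 ℓ p) <_) (length-expand-opp ℓ x p)
                         (subst (_< length (expand 0 ℓ (opp x ∷ p))) (cong suc (+-comm (length (expand 0 ℓ p)) a)) hi)))
  ...   | m , eq′ = Found-cong (i ∷ is) history
    (cut-sound i is (split p) (half₁ x) (half₂ x ∷ split s) (split t) (splitForm b f) (map (splitForm b) h) ℓ′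
      size
      (trans (cong₂ (λ u v → walk (rev u ++ v) (i ∷ is)) (same p) (trans (cong (expand 0 ℓ′) word) (same (x ∷ s ++ t)))) eq)
      (subst (λ k → Bounded k is) (sym (cong₂ (λ u v → length u + length v) (same p) (trans (cong (expand 0 ℓ′) word₁) (same (x ∷ s))))) bd)
      (subst (λ k → Linked _≢_ (k ∷ i ∷ is)) (sym (eval-refine x a m ℓ ℓx f)) ln))
    where
    b = index x
    split = splitWord b
    ℓ′ = refine x a m ℓ
    ℓx : ℓ b ≡ suc (a + m)
    ℓx = sym (suc-injective eq′)
    same : ∀ w → expand 0 ℓ′ (split w) ≡ expand 0 ℓ w
    same = expand-refine x a m ℓ ℓx
    word₁ : half₁ x ∷ half₂ x ∷ split s ≡ split (x ∷ s)
    word₁ = cong (_++ split s) (sym (splitEntry-self x))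
    word : half₁ x ∷ (half₂ x ∷ split s) ++ split t ≡ split (x ∷ s ++ t)
    word = trans (cong (_++ split t) word₁) (sym (concatMap-++ (splitEntry b) (x ∷ s) t))
    size : i ≡ length (expand 0 ℓ′ (opp (half₁ x) ∷ split p))
    size = begin
      suc (length (expand 0 ℓ p) + a)                            ≡⟨ cong suc (+-comm _ a) ⟩
      suc (a + length (expand 0 ℓ p))                            ≡⟨ cong₂ (λ u v → suc (u + length v)) (refine-half₁ x a m ℓ) (same p) ⟨
      suc (ℓ′ (index (half₁ x)) + length (expand 0 ℓ′ (split p))) ≡⟨ length-expand-opp ℓ′ (half₁ x) (split p) ⟨
      length (expand 0 ℓ′ (opp (half₁ x) ∷ split p))             ∎
      where open ≡-Reasoning
    history : map (eval ℓ′) (map (splitForm b) (f ∷ h)) ≡ map (eval ℓ) (f ∷ h)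
    history = trans (sym (map-∘ (f ∷ h))) (map-cong (eval-refine x a m ℓ ℓx) (f ∷ h))

  flips-sound i is p [] t f h ℓ eq lo ((_ , hi) ∷ bd) ln =
    contradiction (≤-trans hi (≤-reflexive (+-identityʳ _))) (<⇒≱ lo)
  flips-sound i is p (x ∷ s) t f h ℓ eq lo bd@((_ , hi) ∷ bd′) ln with <-cmp i (length (expand 0 ℓ (opp x ∷ p)))
  ... | tri≈ _ i≡ _ = Any.++⁺ˡ {ys = cutInside r p x s t f h ++ flips (suc r) (opp x ∷ p) s t f h}
    (cut-sound i is p x s t f h ℓ i≡ eq bd′ ln)
    where r = length is
  ... | tri> _ _ i> = Any.++⁺ʳ (cutAfter r p x s t f h) (Any.++⁺ʳ (cutInside r p x s t f h)
    (flips-sound i is (opp x ∷ p) s t f h ℓ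
      (trans (cong (λ w → walk w (i ∷ is)) (sym (rev-expand-shift ℓ p x (s ++ t)))) eq) i>
      (subst (λ k → Bounded k (i ∷ is)) (sym (length-shift ℓ p x s)) bd) ln))
    where r = length is
  ... | tri< i< _ _ = Any.++⁺ʳ (cutAfter r p x s t f h)
    (Any.++⁺ˡ {ys = flips (suc r) (opp x ∷ p) s t f h} (interior-sound i is p x s t f h ℓ lo i< eq bd′ ln))
    where r = length is

-- Outcome of the search.

-- With block sizes `a, b, c` and in order of time, the first is family (1) with `k = a + b + c`,
-- `j = b + c`, `i = b`. The others are `form2` with `i = a`, `j = b`, `k = a + b`, and with
-- `i = a`, `j = c`, `k = a + b + c`.
solution₁ solution₂ solution₃ : List Form
solution₁ = (1 ∷ 1 ∷ []) ∷ (0 ∷ 1 ∷ []) ∷ (1 ∷ 1 ∷ []) ∷ (1 ∷ 1 ∷ 1 ∷ []) ∷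
            (0 ∷ 1 ∷ 1 ∷ []) ∷ (0 ∷ 1 ∷ []) ∷ (0 ∷ 1 ∷ 1 ∷ []) ∷ (1 ∷ 1 ∷ 1 ∷ []) ∷ []
solution₂ = (1 ∷ []) ∷ (1 ∷ 1 ∷ []) ∷ (0 ∷ 1 ∷ []) ∷ (1 ∷ 1 ∷ []) ∷
            (1 ∷ []) ∷ (1 ∷ 1 ∷ []) ∷ (0 ∷ 1 ∷ []) ∷ (1 ∷ 1 ∷ []) ∷ []
solution₃ = (1 ∷ []) ∷ (1 ∷ 1 ∷ 1 ∷ []) ∷ (0 ∷ 0 ∷ 1 ∷ []) ∷ (1 ∷ 1 ∷ 1 ∷ []) ∷
            (1 ∷ []) ∷ (1 ∷ 1 ∷ 1 ∷ []) ∷ (0 ∷ 0 ∷ 1 ∷ []) ∷ (1 ∷ 1 ∷ 1 ∷ []) ∷ []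

-- Block 0 is the prefix just reversed by the first flip, block 1 all that lies beyond it, and seven
-- flips remain. Type checking runs the whole search.
search-solutions : search 7 (neg 0 ∷ []) (pos 1 ∷ []) (1 ∷ []) [] ≡ solution₁ ∷ solution₂ ∷ solution₃ ∷ []
search-solutions = refl

solve : ∀ i o is → length is ≡ 7 → walk (up 0 (i + suc o)) (i ∷ is) ≡ up 0 (i + suc o) →
  Bounded i (i ∷ is) → Linked _≢_ (i ∷ is) → Found is [ i ] (solution₁ ∷ solution₂ ∷ solution₃ ∷ [])
solve (suc k) o is len eq (_ ∷ bd) ln = subst (Found is [ suc k ]) search-solutions (Found-cong is (cong [_] first)
  (subst (λ r → Found is [ eval ℓ (1 ∷ []) ] (search r (neg 0 ∷ []) (pos 1 ∷ []) (1 ∷ []) [])) len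
    (search-sound (suc k + suc o) is (neg 0 ∷ []) (pos 1 ∷ []) (1 ∷ []) [] ℓ
      (trans (cong (λ u → walk u is) after) eq)
      (subst (λ e → Bounded e is) size bd)
      (subst (λ e → Linked _≢_ (e ∷ is)) (sym first) ln))))
  where
  ℓ : Lengths
  -- Only blocks 0 and 1 occur, with sizes `suc k` and `suc o`; the value at larger indices is a
  -- default.
  ℓ zero    = k
  ℓ (suc _) = o
  first : eval ℓ (1 ∷ []) ≡ suc k
  first = trans (+-identityʳ _) (+-identityʳ (suc k))
  size : suc k ≡ length (expand 0 ℓ (neg 0 ∷ []))
  size = sym (trans (length-expand-∷ ℓ (neg 0) []) (+-identityʳ (suc k)))
  after : expand 0 ℓ (neg 0 ∷ pos 1 ∷ []) ≡ flip (up 0 (suc k + suc o)) (suc k)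
  after = begin
    rev (up 0 (suc k)) ++ (up (suc k) (suc o) ++ [])            ≡⟨ cong (rev (up 0 (suc k)) ++_) (++-identityʳ _) ⟩
    rev (up 0 (suc k)) ++ up (suc k) (suc o)                    ≡⟨ flip-++ (up 0 (suc k)) (up (suc k) (suc o)) ⟨
    flip (up 0 (suc k) ++ up (suc k) (suc o)) (length (up 0 (suc k)))
      ≡⟨ cong₂ flip (sym (up-+ 0 (suc k) (suc o))) (length-up 0 (suc k)) ⟩
    flip (up 0 (suc k + suc o)) (suc k)                         ∎
    where open ≡-Reasoning

-- Transfer from the identity to a signed permutation w

-- The default 0 never matters for injectivity, which is claimed for in-range positions only.
nth : List ℤ → ℕ → ℤ
nth []      _       = 0ℤ
nth (x ∷ w) zero    = x
nth (x ∷ w) (suc a) = nth w a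

lift : List ℤ → Entry → ℤ
lift w (pos a) = nth w a
lift w (neg a) = - nth w a

lift-opp : ∀ w e → lift w (opp e) ≡ - lift w e
lift-opp w (pos a) = refl
lift-opp w (neg a) = sym (neg-involutive (nth w a))

-- `lift w` acts on values and a flip on positions, so they commute: this is left against right
-- multiplication.
map-lift-flip : ∀ w u i → map (lift w) (flip u i) ≡ map (lift w) u ·r i
map-lift-flip w u i = begin
  map f (rev (take i u) ++ drop i u)                      ≡⟨ map-++ f (rev (take i u)) (drop i u) ⟩
  map f (reverse (map opp (take i u))) ++ map f (drop i u) ≡⟨ cong₂ _++_ (reverse-map f (map opp (take i u))) (sym (drop-map i u)) ⟩
  reverse (map f (map opp (take i u))) ++ drop i (map f u) ≡⟨ cong (λ v → reverse v ++ drop i (map f u)) commute ⟩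
  reverse (map -_ (take i (map f u))) ++ drop i (map f u)  ∎
  where
  open ≡-Reasoning
  f = lift w
  commute : map f (map opp (take i u)) ≡ map -_ (take i (map f u))
  commute = begin
    map f (map opp (take i u))  ≡⟨ map-∘ (take i u) ⟨
    map (f ∘ opp) (take i u)    ≡⟨ map-cong (lift-opp w) (take i u) ⟩
    map (-_ ∘ f) (take i u)     ≡⟨ map-∘ (take i u) ⟩
    map -_ (map f (take i u))   ≡⟨ cong (map -_) (sym (take-map i u)) ⟩
    map -_ (take i (map f u))   ∎

map-lift-walk : ∀ w u is → map (lift w) (walk u is) ≡ walkEnd (map (lift w) u) is
map-lift-walk w u []       = refl
map-lift-walk w u (i ∷ is) = trans (map-lift-walk w (flip u i) is) (cong (λ v → walkEnd v is) (map-lift-flip w u i))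

map-lift-up : ∀ w → map (lift w) (up 0 (length w)) ≡ w
map-lift-up w = go 0 w (λ _ → refl)
  where
  -- `v` is the tail of `w` from position `o` on.
  go : ∀ o v → (∀ a → nth w (o + a) ≡ nth v a) → map (lift w) (up o (length v)) ≡ v
  go o []      _  = refl
  go o (x ∷ v) eq = cong₂ _∷_ (trans (cong (nth w) (sym (+-identityʳ o))) (eq 0))
    (go (suc o) v (λ a → trans (cong (nth w) (sym (+-suc o a))) (eq (suc a))))

nth-All : ∀ {P : ℤ → Set} {w} → All P w → ∀ {a} → a < length w → P (nth w a)
nth-All (p ∷ ps) {zero}  _         = p
nth-All (p ∷ ps) {suc a} (s≤s a<n) = nth-All ps a<n

nth-injective : ∀ {w} → Unique (map ∣_∣ w) → ∀ {a b} → a < length w → b < length w →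
  ∣ nth w a ∣ ≡ ∣ nth w b ∣ → a ≡ b
nth-injective {x ∷ w} (x∉ ∷ u) {zero}  {zero}  _ _ _  = refl
nth-injective {x ∷ w} (x∉ ∷ u) {zero}  {suc b} _ (s≤s b<) eq = contradiction eq (nth-All (All.map⁻ x∉) b<)
nth-injective {x ∷ w} (x∉ ∷ u) {suc a} {zero}  (s≤s a<) _ eq = contradiction (sym eq) (nth-All (All.map⁻ x∉) a<)
nth-injective {x ∷ w} (x∉ ∷ u) {suc a} {suc b} (s≤s a<) (s≤s b<) eq = cong suc (nth-injective u a< b< eq)

-‿fixed⇒0 : ∀ x → x ≡ - x → ∣ x ∣ ≡ 0
-‿fixed⇒0 (ℤ.pos zero)    _  = refl
-‿fixed⇒0 (ℤ.pos (suc _)) ()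
-‿fixed⇒0 (ℤ.negsuc _)    ()

InRange : List ℤ → Entry → Set
InRange w e = index e < length w

module _ {w : List ℤ} (unique : Unique (map ∣_∣ w)) (nonzero : All (λ x → ∣ x ∣ ≢ 0) w) where

  -- Equal lifts have equal absolute values, hence equal positions; opposite signs would make an
  -- entry its own negative, so zero.
  lift-injective : ∀ {d e} → InRange w d → InRange w e → lift w d ≡ lift w e → d ≡ e
  lift-injective {pos a} {pos b} a< b< eq = cong pos (nth-injective unique a< b< (cong ∣_∣ eq))
  lift-injective {neg a} {neg b} a< b< eq = cong neg (nth-injective unique a< b<
    (trans (sym (∣-i∣≡∣i∣ (nth w a))) (trans (cong ∣_∣ eq) (∣-i∣≡∣i∣ (nth w b)))))
  lift-injective {pos a} {neg b} a< b< eq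
    with refl ← nth-injective unique a< b< (trans (cong ∣_∣ eq) (∣-i∣≡∣i∣ (nth w b)))
    = contradiction (-‿fixed⇒0 (nth w a) eq) (nth-All nonzero a<)
  lift-injective {neg a} {pos b} a< b< eq
    with refl ← nth-injective unique a< b< (trans (sym (∣-i∣≡∣i∣ (nth w a))) (cong ∣_∣ eq))
    = contradiction (-‿fixed⇒0 (nth w a) (sym eq)) (nth-All nonzero a<)

  map-lift-injective : ∀ {u v} → All (InRange w) u → All (InRange w) v → map (lift w) u ≡ map (lift w) v → u ≡ v
  map-lift-injective []       []       _  = refl
  map-lift-injective (p ∷ ps) (q ∷ qs) eq with ∷-injective eq
  ... | eq₁ , eq₂ = cong₂ _∷_ (lift-injective p q eq₁) (map-lift-injective ps qs eq₂)

  InRange-up : ∀ o l → o + l ≤ length w → All (InRange w) (up o l)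
  InRange-up o zero    _ = []
  InRange-up o (suc l) h = <-≤-trans (m<m+n o z<s) h ∷ InRange-up (suc o) l (≤-trans (≤-reflexive (sym (+-suc o l))) h)

  InRange-rev : ∀ {u} → All (InRange w) u → All (InRange w) (rev u)
  InRange-rev []                       = []
  InRange-rev {e ∷ u} (p ∷ ps) rewrite rev-∷ e u =
    All.++⁺ (InRange-rev ps) (subst (_< length w) (sym (index-opp e)) p ∷ [])

  InRange-walk : ∀ {u} is → All (InRange w) u → All (InRange w) (walk u is)
  InRange-walk []       ps = ps
  InRange-walk (i ∷ is) ps = InRange-walk is (All.++⁺ (InRange-rev (All.take⁺ i ps)) (All.drop⁺ i ps))

  -- The walk at `w` is the image of the walk at the identity under `lift w`, which can be
  -- cancelled.
  walk-closed : ∀ is → walkEnd w is ≡ w → walk (up 0 (length w)) is ≡ up 0 (length w)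
  walk-closed is closed = map-lift-injective (InRange-walk is range) range (begin
    map (lift w) (walk (up 0 (length w)) is)     ≡⟨ map-lift-walk w (up 0 (length w)) is ⟩
    walkEnd (map (lift w) (up 0 (length w))) is  ≡⟨ cong (λ v → walkEnd v is) (map-lift-up w) ⟩
    walkEnd w is                                 ≡⟨ closed ⟩
    w                                            ≡⟨ map-lift-up w ⟨
    map (lift w) (up 0 (length w))               ∎)
    where
    open ≡-Reasoning
    range = InRange-up 0 (length w) ≤-refl

signedPerm-length : ∀ n w → IsSignedPerm n w → length w ≡ n
signedPerm-length n w perm = begin
  length w                  ≡⟨ length-map ∣_∣ w ⟨
  length (map ∣_∣ w)        ≡⟨ ↭-length perm ⟩
  length (map suc (upTo n)) ≡⟨ length-map suc (upTo n) ⟩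
  length (upTo n)           ≡⟨ length-upTo n ⟩
  n                         ∎
  where open ≡-Reasoning

signedPerm-closed : ∀ n w is → IsSignedPerm n w → walkEnd w is ≡ w → walk (up 0 n) is ≡ up 0 n
signedPerm-closed n w is perm closed = subst (λ m → walk (up 0 m) is ≡ up 0 m) (signedPerm-length n w perm)
  (walk-closed
    (Unique-resp-↭ (↭⇒↭ₛ (↭-sym perm)) (Unique.map⁺ suc-injective (Unique.upTo⁺ n)))
    (All.map⁻ (All-resp-↭ {P = _≢ 0} (↭-sym perm) (All.map⁺ (All.universal (λ _ ()) (upTo n)))))
    is closed)

-- From the solutions to the four families.

-- A prefix reversal is an involution, so two equal successive labels would return to `v`.
backtrack : ∀ {v i j} → v ≢ (v ·r i) ·r j → i ≢ j
backtrack {v} {i} v≢ refl = v≢ (sym (ℤReversal.flip-involutive v i))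

≤lex⇒≤ : ∀ {x y} {A : Set} → (x < y) ⊎ (x ≡ y × A) → x ≤ y
≤lex⇒≤ (inj₁ x<y)        = <⇒≤ x<y
≤lex⇒≤ (inj₂ (refl , _)) = ≤-refl

-- The relation `k + i ≡ j + j′` expresses `j′ = k - j + i` without truncated subtraction.
listed₁ : ∀ n {i j j′ k} → k + i ≡ j + j′ → 1 ≤ i → i < j → j < k → k ≤ n →
  IsListed n (k ∷ j ∷ i ∷ j ∷ k ∷ j′ ∷ i ∷ j′ ∷ [])
listed₁ n {i} {j} {j′} {suc k} eq 1≤i i<j (s≤s j≤k) k≤n = inj₁ (i , j , suc k ,
  cong (λ m → suc k ∷ j ∷ i ∷ j ∷ suc k ∷ m ∷ i ∷ m ∷ []) j′≡ ,
  1≤i , i<j , j≤k , s≤s (≤-trans (≤-trans (s≤s 1≤i) i<j) j≤k) , k≤n)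
  where
  j′≡ : j′ ≡ suc k ∸ j + i
  j′≡ = trans (sym (m+n∸m≡n j j′)) (trans (cong (_∸ j) (sym eq)) (+-∸-comm i (m≤n⇒m≤1+n j≤k)))

-- Family (4) is `i = j = 1`, family (3) is `i = 1 < j`, and family (2) has both at least 2;
-- canonicity rules out `j = 1 < i`.
listed₂ : ∀ n {i j k} → 1 ≤ i → 1 ≤ j → i + j ≤ k → k ≤ n → IsCanonical (form2 i j k) → IsListed n (form2 i j k)
listed₂ n {suc zero} {suc zero} {k} _ _ i+j≤k k≤n _ = inj₂ (inj₂ (inj₂ (k , refl , i+j≤k , k≤n)))
listed₂ n {suc zero} {suc (suc j)} {suc k} _ _ i+j≤k@(s≤s j≤k) k≤n _ =
  inj₂ (inj₂ (inj₁ (suc (suc j) , suc k , refl , s≤s (s≤s z≤n) , j≤k , ≤-trans (s≤s (s≤s (s≤s z≤n))) i+j≤k , k≤n)))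
listed₂ n {suc (suc i)} {suc zero} {k} _ _ _ _ canonical
  -- Rotation by two exchanges `i` and `j`, and so would give a larger sequence.
  with proj₁ (canonical 2 (s≤s (s≤s (s≤s z≤n))))
... | inj₁ k<k                          = contradiction refl (<⇒≢ k<k)
... | inj₂ (_ , inj₁ (s≤s ()))
... | inj₂ (_ , inj₂ (() , _))
listed₂ n {i@(suc (suc i′))} {j@(suc (suc j′))} {k} _ _ i+j≤k k≤n _ =
  inj₂ (inj₁ (i , j , k , refl , s≤s (s≤s z≤n) ,
    ≤-trans (m+n≤o⇒m≤o∸n i i+j≤k) (∸-monoʳ-≤ k (s≤s (s≤s z≤n))) , s≤s (s≤s z≤n) ,
    ≤-trans (m+n≤o⇒m≤o∸n j (≤-trans (≤-reflexive (+-comm j i)) i+j≤k)) (∸-monoʳ-≤ k (s≤s (s≤s z≤n))) , i+j≤k ,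
    ≤-trans (+-mono-≤ {2} {i} {2} (s≤s (s≤s z≤n)) (s≤s (s≤s z≤n))) i+j≤k , k≤n))

classify : ∀ n k is → k ≤ n → IsCanonical (k ∷ is) →
  Found is [ k ] (solution₁ ∷ solution₂ ∷ solution₃ ∷ []) → length is ≡ 7 → IsListed n (k ∷ is)
-- Matching the equation replaces each label by the value of its form; `balance` is then
-- `k + i = j + j′`.
classify n k (_ ∷ _ ∷ _ ∷ _ ∷ _ ∷ _ ∷ _ ∷ []) k≤n canonical (here (ℓ , refl)) refl =
  listed₁ n (balance (ℓ 0) (ℓ 1) (ℓ 2)) z<s (+-monoʳ-< (1 * suc (ℓ 1)) z<s) (m<n+m _ z<s) k≤n
  where
  balance : ∀ a b c → 1 * suc a + (1 * suc b + (1 * suc c + 0)) + (1 * suc b + 0)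
                      ≡ (1 * suc b + (1 * suc c + 0)) + (1 * suc a + (1 * suc b + 0))
  balance = solve-∀
classify n k (_ ∷ _ ∷ _ ∷ _ ∷ _ ∷ _ ∷ _ ∷ []) k≤n canonical (there (here (ℓ , refl))) refl =
  listed₂ n z<s z<s (≤-reflexive (total (ℓ 0) (ℓ 1))) k≤n canonical
  where
  total : ∀ a b → (1 * suc a + 0) + (1 * suc b + 0) ≡ 1 * suc a + (1 * suc b + 0)
  total = solve-∀
classify n k (_ ∷ _ ∷ _ ∷ _ ∷ _ ∷ _ ∷ _ ∷ []) k≤n canonical (there (there (here (ℓ , refl)))) refl =
  listed₂ n z<s z<s
    (≤-trans (m≤m+n _ (1 * suc (ℓ 1))) (≤-reflexive (total (ℓ 0) (ℓ 1) (ℓ 2)))) k≤n canonical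
  where
  total : ∀ a b c → (1 * suc a + 0) + (1 * suc c + 0) + 1 * suc b ≡ 1 * suc a + (1 * suc b + (1 * suc c + 0))
  total = solve-∀

theorem4p1 : (n : ℕ) → 2 ≤ n → (w : List ℤ) → IsSignedPerm n w →
    (is : List ℕ) → length is ≡ 8 → All (λ i → (1 ≤ i) × (i ≤ n)) is →
    IsCycle w is → IsCanonical is → IsListed n is
theorem4p1 n _ w perm is@(i₁ ∷ i₂ ∷ i₃ ∷ i₄ ∷ i₅ ∷ i₆ ∷ i₇ ∷ i₈ ∷ []) refl bounds@((_ , i₁≤n) ∷ _)
  (_ , closed , (_ ∷ p₁ ∷ _ ∷ _ ∷ _ ∷ p₇ ∷ _) ∷ (_ ∷ p₂ ∷ _) ∷ (_ ∷ p₃ ∷ _) ∷ (_ ∷ p₄ ∷ _) ∷ (_ ∷ p₅ ∷ _) ∷ (_ ∷ p₆ ∷ _) ∷ _)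
  canonical =
  classify n i₁ is₇ i₁≤n canonical (solve i₁ (n ∸ i₁) is₇ refl closed⁺ maximal turns) refl
  where
  is₇ : List ℕ
  is₇ = i₂ ∷ i₃ ∷ i₄ ∷ i₅ ∷ i₆ ∷ i₇ ∷ i₈ ∷ []

  closed⁺ : walk (up 0 (i₁ + suc (n ∸ i₁))) is ≡ up 0 (i₁ + suc (n ∸ i₁))
  -- Blocks are nonempty, but nothing lies beyond the first flip when `i₁ = n`. An extra entry that
  -- is never moved is therefore appended, leaving `1 + (n - i₁)` entries for block 1.
  closed⁺ = subst (λ N → walk (up 0 N) is ≡ up 0 N) (sym (trans (+-suc i₁ (n ∸ i₁)) (cong suc (m+[n∸m]≡n i₁≤n)))) (begin
    walk (up 0 (suc n)) is       ≡⟨ cong (λ u → walk u is) (up-last 0 n) ⟩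
    walk (up 0 n ∷ʳ pos n) is    ≡⟨ walk-++ (up 0 n) [ pos n ] is
                                      (All.map (λ i≤n → ≤-trans (proj₂ i≤n) (≤-reflexive (sym (length-up 0 n)))) bounds) ⟩
    walk (up 0 n) is ∷ʳ pos n    ≡⟨ cong (_∷ʳ pos n) (signedPerm-closed n w is perm closed) ⟩
    up 0 n ∷ʳ pos n              ≡⟨ up-last 0 n ⟨
    up 0 (suc n)                 ∎)
    where open ≡-Reasoning

  maximal : Bounded i₁ is
  -- Every label starts some rotation, so by canonicity it is at most `i₁`.
  maximal = All.zipWith (λ ((1≤i , _) , i≤i₁) → 1≤i , i≤i₁) (bounds ,
    (≤lex⇒≤ (rotation 0) ∷ ≤lex⇒≤ (rotation 1) ∷ ≤lex⇒≤ (rotation 2) ∷ ≤lex⇒≤ (rotation 3) ∷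
     ≤lex⇒≤ (rotation 4) ∷ ≤lex⇒≤ (rotation 5) ∷ ≤lex⇒≤ (rotation 6) ∷ ≤lex⇒≤ (rotation 7) ∷ []))
    where
    rotation : ∀ t {t<8 : True (t <? 8)} → rotate t is ≤lex is
    rotation t {t<8} = proj₁ (canonical t (toWitness t<8))

  turns : Linked _≢_ is
  turns = backtrack p₁ ∷ backtrack p₂ ∷ backtrack p₃ ∷ backtrack p₄ ∷ backtrack p₅ ∷ backtrack p₆ ∷
          -- The vertex after eight flips is `w` again, so the last turn uses that the seventh
          -- vertex differs from the first.
          backtrack (λ eq → p₇ (trans (sym closed) (sym eq))) ∷ [-]
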